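{- For every pair of positive integers $g,k$, there is a graph $G_{g,k}$ with girth at least $g$ and chromatic number at least $k$ that has a proper edge-colouring in which each cycle contains no colour exactly once.
   Context: A proper edge-colouring assigns colours to edges so that edges sharing a vertex receive distinct colours. "Each cycle contains no colour exactly once" means: for every cycle $C$ of the graph and every colour $c$, the number of edges of $C$ with colour $c$ is not equal to $1$. Graphs are finite and simple. -}

module Defs where

open import Level using (0ℓ)
open import Data.Nat using (ℕ; suc; _≤_)
open import Data.Fin using (Fin)
open import Data.List using (List; []; _∷_; length; filter)
open import Data.List.Relation.Unary.Unique.Propositional using (Unique)
open import Data.Product using (Σ-syntax)
open import Function.Bundles using (_↔_)
open import Relation.Binary.Core using (Rel)
open import Relation.Binary.Definitions
  using (Decidable; DecidableEquality; Irreflexive; Symmetric)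
open import Relation.Binary.PropositionalEquality using (_≡_; _≢_)
open import Relation.Unary using (Pred)

record Graph : Set₁ where
  field
    Vertex : Set
    order  : ℕ
    finite : Vertex ↔ Fin order
    Adj    : Rel Vertex 0ℓ
    adj?   : Decidable Adj
    irrefl : Irreflexive _≡_ Adj
    symm   : Symmetric Adj

module _ (G : Graph) where
  open Graph G

  data Walk : Vertex → Vertex → Set where
    nil  : ∀ {u} → Walk u u
    cons : ∀ {u v w} → Adj u v → Walk v w → Walk u w

-- The vertices of a walk, in order, without the final one.
vertices : ∀ {G u v} → Walk G u v → List (Graph.Vertex G)
vertices nil                = []
vertices (cons {u = u} _ p) = u ∷ vertices p

size : ∀ {G u v} → Walk G u v → ℕ
size nil        = 0
size (cons _ p) = suc (size p)

-- Every cycle occurs once for each choice of starting vertex and direction.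
-- The bound 3 excludes the empty walk and walking back and forth along a
-- single edge, so that a cycle traverses each of its edges exactly once.
record Cycle (G : Graph) : Set where
  field
    {base}   : Graph.Vertex G
    walk     : Walk G base base
    long     : 3 ≤ size walk
    distinct : Unique (vertices walk)

Colourable : Graph → Pred ℕ 0ℓ
Colourable G m =
  Σ[ f ∈ (Vertex → Fin m) ] (∀ {u v} → Adj u v → f u ≢ f v)
  where open Graph G

CycleLength : Graph → Pred ℕ 0ℓ
CycleLength G n = Σ[ C ∈ Cycle G ] size (Cycle.walk C) ≡ n

-- k ≤min P says that the minimum of P is at least k, the minimum of the empty
-- set being ∞.
_≤min_ : ℕ → Pred ℕ 0ℓ → Set
k ≤min P = ∀ n → P n → k ≤ n

-- The girth is the minimum length of a cycle (∞ for forests).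
GirthAtLeast : ℕ → Graph → Set
GirthAtLeast g G = g ≤min CycleLength G

-- The chromatic number is the minimum m such that G is m-colourable.
ChromaticNumberAtLeast : ℕ → Graph → Set
ChromaticNumberAtLeast k G = k ≤min Colourable G

-- By coherent, the colour of uv depends neither on the orientation of the edge
-- nor on the proof of adjacency.
record EdgeColouring (G : Graph) : Set₁ where
  open Graph G
  field
    Colour   : Set
    _≟_      : DecidableEquality Colour
    colour   : ∀ {u v} → Adj u v → Colour
    coherent : ∀ {u v} (e : Adj u v) (e′ : Adj v u) → colour e ≡ colour e′

module _ {G : Graph} (κ : EdgeColouring G) where
  open Graph G
  open EdgeColouring κ

  Proper : Set
  Proper = ∀ {u v w} (e : Adj u v) (f : Adj u w) → v ≢ w → colour e ≢ colour f

  colours : ∀ {u v} → Walk G u v → List Colour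
  colours nil        = []
  colours (cons e p) = colour e ∷ colours p

  occurrences : Colour → Cycle G → ℕ
  occurrences c C = length (filter (c ≟_) (colours (Cycle.walk C)))

  NoColourExactlyOnce : Set
  NoColourExactlyOnce = ∀ (C : Cycle G) (c : Colour) → occurrences c C ≢ 1

{-# OPTIONS --safe #-}
module Submission where

-- The vertices are the points of [n]^d, and an edge of colour c joins two points
-- that differ in coordinate c only.  A cycle with a single edge of colour c would
-- change that coordinate once and never change it back.  The edges of each colour
-- form a matching, so the colouring is proper.
--
-- The edges are chosen greedily.  Every k-colouring of the points makes at least
-- 1/k of all pairs on axis-parallel lines monochromatic.  As long as there are only
-- O(k² N) edges, where N = n^d, at most 1/2k of the pairs are blocked, because an end
-- is already matched in that direction or because the ends are joined by a walk of
-- length at most g: the first kind is rare since d is large compared with k, the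
-- second since n is large compared with (d + 1)^g.  By averaging, some free pair is
-- monochromatic for 1/2k of the k-colourings that are still proper.  Hence all k^N
-- colourings are destroyed after O(k² N) edges.

open import Defs
open import Data.Nat
  using (ℕ; zero; suc; _+_; _*_; _^_; _≤_; _<_; z≤n; s≤s; s≤s⁻¹; NonZero; >-nonZero; >-nonZero⁻¹)
open import Data.Nat.Properties as ℕ hiding (_≟_)
open import Data.Nat.Tactic.RingSolver using (solve-∀)
open import Algebra.Properties.Semiring.Sum ℕ.+-*-semiring
open import Data.Bool using (if_then_else_)
open import Data.Fin using (Fin; zero; suc; inject≤; finToFun; funToFin; combine)
open import Data.Fin.Properties using (_≟_; any?; inject≤-injective; funToFin-finToFin; finToFun-funToFin)
open import Data.List using (length; filter)
open import Data.List.Relation.Unary.All as All using (All; []; _∷_)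
open import Data.List.Relation.Unary.AllPairs using ([]; _∷_)
open import Data.List.Relation.Unary.Unique.Propositional using (Unique)
open import Data.Product
  using (Σ-syntax; ∃; ∃-syntax; ∃₂; _×_; _,_; proj₁; proj₂)
open import Data.Sum using (_⊎_; inj₁; inj₂)
open import Data.Vec.Functional using (updateAt)
open import Data.Vec.Functional.Properties using (updateAt-updates; updateAt-minimal)
open import Function using (_∘_; const; case_of_; it)
open import Function.Construct.Identity using (↔-id)
open import Relation.Binary.Core using (Rel)
open import Relation.Binary.Definitions using (Symmetric)
open import Relation.Binary.PropositionalEquality
  hiding ([_])
open import Relation.Nullary
  using (¬_; Dec; yes; no; does; ¬?; _×-dec_; contradiction)
open import Level using (0ℓ)

-- Indicators and finite sums.

ind : ∀ {P : Set} → Dec P → ℕ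
ind P? = if does P? then 1 else 0

ind≤1 : ∀ {P : Set} (P? : Dec P) → ind P? ≤ 1
ind≤1 (yes _) = ≤-refl
ind≤1 (no _)  = z≤n

ind-yes : ∀ {P : Set} (P? : Dec P) → P → ind P? ≡ 1
ind-yes (yes _) _ = refl
ind-yes (no ¬p) p = contradiction p ¬p

ind-no : ∀ {P : Set} (P? : Dec P) → ¬ P → ind P? ≡ 0
ind-no (yes p) ¬p = contradiction p ¬p
ind-no (no _)  _  = refl

ind-mono : ∀ {P Q : Set} (P? : Dec P) (Q? : Dec Q) → (P → Q) → ind P? ≤ ind Q?
ind-mono (yes p) Q? f = ≤-reflexive (sym (ind-yes Q? (f p)))
ind-mono (no _)  Q? f = z≤n

∑-mono : ∀ {n} {f h : Fin n → ℕ} → (∀ i → f i ≤ h i) → sum f ≤ sum h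
∑-mono {zero}  _   = z≤n
∑-mono {suc n} f≤h = +-mono-≤ (f≤h zero) (∑-mono (f≤h ∘ suc))

∑-const : ∀ n x → ∑[ _ < n ] x ≡ n * x
∑-const zero    x = refl
∑-const (suc n) x = cong (x +_) (∑-const n x)

∑-upper : ∀ {n} {f : Fin n → ℕ} {B} → (∀ i → f i ≤ B) → sum f ≤ n * B
∑-upper {n} f≤B = ≤-trans (∑-mono f≤B) (≤-reflexive (∑-const n _))

∑-lower : ∀ {n} {f : Fin n → ℕ} {B} → (∀ i → B ≤ f i) → n * B ≤ sum f
∑-lower {n} B≤f = ≤-trans (≤-reflexive (sym (∑-const n _))) (∑-mono B≤f)

term≤∑ : ∀ {n} (f : Fin n → ℕ) i → f i ≤ sum f
term≤∑ f zero    = m≤m+n _ _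
term≤∑ f (suc i) = ≤-trans (term≤∑ (f ∘ suc) i) (m≤n+m _ _)

∑-search : ∀ {n} (f : Fin n → ℕ) {B} → n * B < sum f → ∃ λ i → B < f i
∑-search {suc n} f {B} B<∑ with <-≤-connex B (f zero)
... | inj₁ B<f₀ = zero , B<f₀
... | inj₂ f₀≤B = let i , B<fᵢ = ∑-search (f ∘ suc) rest in suc i , B<fᵢ
  where
  rest : n * B < sum (f ∘ suc)
  rest = +-cancelˡ-< B _ _ (<-≤-trans B<∑ (+-monoˡ-≤ _ f₀≤B))

∑-ind : ∀ {n} (i : Fin n) (f : Fin n → ℕ) → ∑[ j < n ] (ind (i ≟ j) * f j) ≡ f i
∑-ind {suc n} zero f = begin
  1 * f zero + ∑[ j < n ] 0  ≡⟨ cong₂ _+_ (*-identityˡ (f zero)) (trans (∑-const n 0) (*-zeroʳ n)) ⟩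
  f zero + 0                 ≡⟨ +-identityʳ _ ⟩
  f zero                     ∎
  where open ≡-Reasoning
∑-ind {suc n} (suc i) f = ∑-ind i (f ∘ suc)

∑-ind₁ : ∀ {n} (i : Fin n) → ∑[ j < n ] ind (i ≟ j) ≡ 1
∑-ind₁ {n} i = trans (sum-cong-≗ {n} λ j → sym (*-identityʳ (ind (i ≟ j)))) (∑-ind i (const 1))

-- Double counting: `f z` is picked up once for each pair with `φ x a ≡ z`, hence at most `B` times.
∑-fibres : ∀ {p q r} (φ : Fin p → Fin q → Fin r) {B} →
           (∀ z → ∑[ x < p ] ∑[ a < q ] ind (φ x a ≟ z) ≤ B) →
           (f : Fin r → ℕ) → ∑[ x < p ] ∑[ a < q ] f (φ x a) ≤ B * sum f
∑-fibres {p} {q} {r} φ {B} fibre≤B f = begin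
  ∑[ x < p ] ∑[ a < q ] f (φ x a)
    ≡⟨ (sum-cong-≗ {p} λ x → sum-cong-≗ {q} λ a → ∑-ind (φ x a) f) ⟨
  ∑[ x < p ] ∑[ a < q ] ∑[ z < r ] (ind (φ x a ≟ z) * f z)
    ≡⟨ (sum-cong-≗ {p} λ x → ∑-comm {q} {r} λ a z → ind (φ x a ≟ z) * f z) ⟩
  ∑[ x < p ] ∑[ z < r ] ∑[ a < q ] (ind (φ x a ≟ z) * f z)
    ≡⟨ (∑-comm {p} {r} λ x z → ∑[ a < q ] (ind (φ x a ≟ z) * f z)) ⟩
  ∑[ z < r ] ∑[ x < p ] ∑[ a < q ] (ind (φ x a ≟ z) * f z)
    ≡⟨ (sum-cong-≗ {r} λ z → trans
          (*-distribʳ-sum {p} (f z) (λ x → ∑[ a < q ] ind (φ x a ≟ z)))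
          (sum-cong-≗ {p} λ x → *-distribʳ-sum {q} (f z) (λ a → ind (φ x a ≟ z)))) ⟨
  ∑[ z < r ] ((∑[ x < p ] ∑[ a < q ] ind (φ x a ≟ z)) * f z)
    ≤⟨ (∑-mono {r} λ z → *-monoˡ-≤ (f z) (fibre≤B z)) ⟩
  ∑[ z < r ] (B * f z)
    ≡⟨ *-distribˡ-sum {r} B f ⟨
  B * sum f
    ∎
  where open ≤-Reasoning

-- Monochromatic pairs on one line.

2ab≤a²+b² : ∀ a b → 2 * a * b ≤ a * a + b * b
2ab≤a²+b² a b with ≤-total a b
... | inj₁ a≤b with c , refl ← m≤n⇒∃[o]m+o≡n a≤b =
  ≤-trans (m≤m+n _ (c * c)) (≤-reflexive (identity a c))
  where
  identity : ∀ a c → 2 * a * (a + c) + c * c ≡ a * a + (a + c) * (a + c)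
  identity = solve-∀
... | inj₂ b≤a with c , refl ← m≤n⇒∃[o]m+o≡n b≤a =
  ≤-trans (m≤m+n _ (c * c)) (≤-reflexive (identity b c))
  where
  identity : ∀ b c → 2 * (b + c) * b + c * c ≡ (b + c) * (b + c) + b * b
  identity = solve-∀

-- Cauchy-Schwarz: the `k` class sizes sum to `k * t`, so their squares sum to at least
-- `k * (t * t)`. As `k` divides the number of points, the mean `t` is an integer, and it suffices
-- to sum `2 * t * s ≤ t * t + s * s` over the class sizes `s`.
monochromatic-pairs : ∀ k t (h : Fin (k * t) → Fin k) →
  k * t * (k * t) ≤ k * (∑[ a < k * t ] ∑[ b < k * t ] ind (h a ≟ h b))
monochromatic-pairs k t h = begin
  n * n            ≡⟨ rearrange k t ⟩
  k * (k * (t * t)) ≤⟨ *-monoʳ-≤ k kt²≤M ⟩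
  k * M            ∎
  where
  open ≤-Reasoning
  n = k * t
  M = ∑[ a < n ] ∑[ b < n ] ind (h a ≟ h b)
  class : Fin k → ℕ
  class c = ∑[ a < n ] ind (h a ≟ c)

  rearrange : ∀ k t → k * t * (k * t) ≡ k * (k * (t * t))
  rearrange = solve-∀

  ∑class : sum class ≡ n
  ∑class = trans (∑-comm {k} {n} λ c a → ind (h a ≟ c))
          (trans (sum-cong-≗ {n} λ a → ∑-ind₁ (h a)) (trans (∑-const n 1) (*-identityʳ n)))

  ∑class² : ∑[ c < k ] (class c * class c) ≤ M
  ∑class² = begin
    ∑[ c < k ] (class c * class c)
      ≡⟨ (sum-cong-≗ {k} λ c → *-distribʳ-sum {n} (class c) (λ a → ind (h a ≟ c))) ⟩
    ∑[ c < k ] ∑[ a < n ] (ind (h a ≟ c) * class c)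
      ≡⟨ (∑-comm {k} {n} λ c a → ind (h a ≟ c) * class c) ⟩
    ∑[ a < n ] ∑[ c < k ] (ind (h a ≟ c) * class c)
      ≡⟨ (sum-cong-≗ {n} λ a → ∑-ind (h a) class) ⟩
    ∑[ a < n ] ∑[ b < n ] ind (h b ≟ h a)
      ≤⟨ (∑-mono {n} λ a → ∑-mono {n} λ b → ind-mono (h b ≟ h a) (h a ≟ h b) sym) ⟩
    M ∎

  kt²≤M : k * (t * t) ≤ M
  kt²≤M = +-cancelʳ-≤ (k * (t * t)) _ _ (begin
    k * (t * t) + k * (t * t)                      ≡⟨ double k t ⟩
    2 * t * n                                      ≡⟨ cong (2 * t *_) ∑class ⟨
    2 * t * sum class                              ≡⟨ *-distribˡ-sum {k} (2 * t) class ⟩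
    ∑[ c < k ] (2 * t * class c)                   ≤⟨ (∑-mono {k} λ c → 2ab≤a²+b² t (class c)) ⟩
    ∑[ c < k ] (t * t + class c * class c)         ≡⟨ ∑-distrib-+ {k} (const (t * t)) (λ c → class c * class c) ⟩
    ∑[ c < k ] (t * t) + ∑[ c < k ] (class c * class c)
                                                   ≤⟨ +-mono-≤ (≤-reflexive (∑-const k (t * t))) ∑class² ⟩
    k * (t * t) + M                                ≡⟨ +-comm _ M ⟩
    M + k * (t * t)                                ∎)
    where
    double : ∀ k t → k * (t * t) + k * (t * t) ≡ 2 * t * (k * t)
    double = solve-∀

-- Exponential estimates.

n<2^n : ∀ n → n < 2 ^ n
n<2^n zero    = s≤s z≤n
n<2^n (suc n) = ≤-trans (+-mono-≤ (m^n>0 2 n) (n<2^n n))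
                        (+-monoʳ-≤ (2 ^ n) (≤-reflexive (sym (+-identityʳ (2 ^ n)))))

-- This is `(1 + 1/m)^r ≥ 1 + r/m` with denominators cleared.
bernoulli : ∀ m r → m ^ r * (m + r) ≤ m * suc m ^ r
bernoulli m zero    = ≤-reflexive (identity m)
  where
  identity : ∀ m → 1 * (m + 0) ≡ m * 1
  identity = solve-∀
bernoulli m (suc r) = begin
  m * m ^ r * (m + suc r)              ≤⟨ m≤m+n _ (m ^ r * r) ⟩
  m * m ^ r * (m + suc r) + m ^ r * r  ≡⟨ identity₁ m (m ^ r) r ⟩
  suc m * (m ^ r * (m + r))            ≤⟨ *-monoʳ-≤ (suc m) (bernoulli m r) ⟩
  suc m * (m * suc m ^ r)              ≡⟨ identity₂ m (suc m ^ r) ⟩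
  m * (suc m * suc m ^ r)              ∎
  where
  open ≤-Reasoning
  identity₁ : ∀ m x r → m * x * (m + suc r) + x * r ≡ suc m * (x * (m + r))
  identity₁ = solve-∀
  identity₂ : ∀ m x → suc m * (m * x) ≡ m * (suc m * x)
  identity₂ = solve-∀

^-submultiplicative : ∀ {x y z} a → x * y ≤ z → x ^ a * y ^ a ≤ z ^ a
^-submultiplicative zero _ = ≤-refl
^-submultiplicative {x} {y} {z} (suc a) xy≤z = ≤-trans
  (≤-reflexive (interchange x (x ^ a) y (y ^ a)))
  (*-mono-≤ xy≤z (^-submultiplicative {x} {y} a xy≤z))
  where
  interchange : ∀ a b c d → a * b * (c * d) ≡ a * c * (b * d)
  interchange = solve-∀

-- `(1 + 1/m)^(m+1) ≥ 2` by Bernoulli, raised to the power `a`: losing a fraction `1/(m+1)`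
-- repeatedly, `m + 1` times, at least halves a quantity.
m^-decay : ∀ m a .{{_ : NonZero m}} → m ^ (suc m * a) * 2 ^ a ≤ suc m ^ (suc m * a)
m^-decay m a = begin
  m ^ (suc m * a) * 2 ^ a      ≡⟨ cong (_* 2 ^ a) (^-*-assoc m (suc m) a) ⟨
  (m ^ suc m) ^ a * 2 ^ a      ≤⟨ ^-submultiplicative a doubling ⟩
  (suc m ^ suc m) ^ a          ≡⟨ ^-*-assoc (suc m) (suc m) a ⟩
  suc m ^ (suc m * a)          ∎
  where
  open ≤-Reasoning
  identity : ∀ m x → m * (x * 2) + x ≡ x * (m + suc m)
  identity = solve-∀
  doubling : m ^ suc m * 2 ≤ suc m ^ suc m
  doubling = *-cancelˡ-≤ m (begin
    m * (m ^ suc m * 2)               ≤⟨ m≤m+n _ (m ^ suc m) ⟩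
    m * (m ^ suc m * 2) + m ^ suc m   ≡⟨ identity m (m ^ suc m) ⟩
    m ^ suc m * (m + suc m)           ≤⟨ bernoulli m (suc m) ⟩
    m * suc m ^ suc m                 ∎)

-- Short cycles when an edge is added.

module _ {A : Set} where

  data Path (R : Rel A 0ℓ) : A → A → ℕ → Set where
    nil  : ∀ {u} → Path R u u 0
    cons : ∀ {u v w l} → R u v → Path R v w l → Path R u w (suc l)

  -- A non-backtracking walk; the first index is the vertex preceding the start.
  data Reduced (R : Rel A 0ℓ) : A → A → A → ℕ → Set where
    nil  : ∀ {p u} → Reduced R p u u 0
    cons : ∀ {p u v w l} → R u v → v ≢ p → Reduced R u v w l → Reduced R p u w (suc l)

  path : ∀ {R p u v l} → Reduced R p u v l → Path R u v l
  path nil          = nil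
  path (cons e _ r) = cons e (path r)

  _++ₚ_ : ∀ {R u v w l m} → Path R u v l → Path R v w m → Path R u w (l + m)
  nil      ++ₚ q = q
  cons e p ++ₚ q = cons e (p ++ₚ q)

  reverseₚ : ∀ {R u v l} → Symmetric R → Path R u v l → Path R v u l
  reverseₚ s nil = nil
  reverseₚ {R} {l = suc l} s (cons e p) =
    subst (Path R _ _) (+-comm l 1) (reverseₚ s p ++ₚ cons (s e) nil)

  NoPath : Rel A 0ℓ → ℕ → Rel A 0ℓ
  NoPath R g u v = ∀ {l} → l ≤ g → ¬ Path R u v l

  -- Closed reduced walks stand in for cycles: they can be cut at an edge without keeping track of
  -- the distinctness of all vertices. Every cycle is one.
  NoShortCycle : Rel A 0ℓ → ℕ → Set
  NoShortCycle R g = ∀ {p u l} → suc l ≤ g → ¬ Reduced R p u u (suc l)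

  data Extends (R : Rel A 0ℓ) (s t : A) (u v : A) : Set where
    old     : R u v → Extends R s t u v
    forward : u ≡ s → v ≡ t → Extends R s t u v
    back    : u ≡ t → v ≡ s → Extends R s t u v

  Extends-swap : ∀ {R s t u v} → Extends R s t u v → Extends R t s u v
  Extends-swap (old e)         = old e
  Extends-swap (forward u≡ v≡) = back u≡ v≡
  Extends-swap (back u≡ v≡)    = forward u≡ v≡

  module _ (R R′ : Rel A 0ℓ) (g : ℕ) (noCycle : NoShortCycle R g) where

    -- The walk is cut where it first uses the new edge. The rest remembers the end it came from, so
    -- it cannot turn back at once.
    data FirstUse (s t p u w : A) (n : ℕ) : Set where
      none : Reduced R p u w n → FirstUse s t p u w n
      use  : ∀ i j → i + suc j ≡ n → Reduced R p u s i → Reduced R′ s t w j →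
             FirstUse s t p u w n
      use⁻ : ∀ i j → i + suc j ≡ n → Reduced R p u t i → Reduced R′ t s w j →
             FirstUse s t p u w n

    firstUse : ∀ {s t p u w n} → (∀ {x y} → R′ x y → Extends R s t x y) →
               Reduced R′ p u w n → FirstUse s t p u w n
    firstUse ext nil = none nil
    firstUse ext (cons e v≢p r) with ext e
    ... | forward refl refl = use 0 _ refl nil r
    ... | back    refl refl = use⁻ 0 _ refl nil r
    ... | old e₀ with firstUse ext r
    ...   | none r₀           = none (cons e₀ v≢p r₀)
    ...   | use i j i+j q r₀  = use (suc i) j (cong suc i+j) (cons e₀ v≢p q) r₀
    ...   | use⁻ i j i+j q r₀ = use⁻ (suc i) j (cong suc i+j) (cons e₀ v≢p q) r₀

    -- A second use of the new edge would close a path from t to s or, on the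
    -- way back, a reduced walk from t to t; both are too short to exist.
    used-once : ∀ {s t w n} → (∀ {x y} → R′ x y → Extends R s t x y) →
                NoPath R g t s → n ≤ g → Reduced R′ s t w n → Reduced R s t w n
    used-once ext far n≤g nil = nil
    used-once ext far n≤g (cons e v≢s r) with ext e
    ... | forward refl refl = contradiction nil (far z≤n)
    ... | back    refl refl = contradiction refl v≢s
    ... | old e₀ with firstUse ext r
    ...   | none r₀            = cons e₀ v≢s r₀
    ...   | use  i j refl q r₀ =
      contradiction (cons e₀ (path q)) (far (≤-trans (s≤s (m≤m+n i (suc j))) n≤g))
    ...   | use⁻ i j refl q r₀ =
      contradiction (cons e₀ v≢s q) (noCycle (≤-trans (s≤s (m≤m+n i (suc j))) n≤g))

    -- By `used-once` the rest `r` avoids the new edge, so `r` followed by `q` is an `R`-path from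
    -- `t` to `s` of length `j + i ≤ g`, which `far` forbids.
    closes : ∀ {s t p u i j n} → (∀ {x y} → R′ x y → Extends R s t x y) → NoPath R g t s →
             n ≤ g → i + suc j ≡ n → Reduced R p u s i → ¬ Reduced R′ s t u j
    closes {i = i} {j} ext far n≤g refl q r =
      far (≤-trans (≤-reflexive (+-comm j i)) (≤-trans (+-monoʳ-≤ i (n≤1+n j)) n≤g))
          (path (used-once ext far (≤-trans (n≤1+n j) (≤-trans (m≤n+m (suc j) i) n≤g)) r) ++ₚ path q)

    noShortCycle-extend : ∀ {s t} → (∀ {x y} → R′ x y → Extends R s t x y) →
                          NoPath R g s t → NoPath R g t s → NoShortCycle R′ g
    noShortCycle-extend ext far far⁻ l<g r with firstUse ext r
    ... | none r₀           = noCycle l<g r₀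
    ... | use  i j i+j q r₀ = closes ext far⁻ l<g i+j q r₀
    ... | use⁻ i j i+j q r₀ = closes (Extends-swap ∘ ext) far l<g i+j q r₀

-- The points of [n]^d and their axis-parallel lines.

funToFin-cong : ∀ {m n} {f h : Fin m → Fin n} → f ≗ h → funToFin f ≡ funToFin h
funToFin-cong {zero}  f≗h = refl
funToFin-cong {suc m} f≗h = cong₂ combine (f≗h zero) (funToFin-cong (f≗h ∘ suc))

module Hamming (n d : ℕ) where

  infixl 8 _at_ _[_≔_]

  -- Points are coded by numbers so that the sums over `Fin` range over them and propositional
  -- equality is decidable.
  V : Set
  V = Fin (n ^ d)

  _at_ : V → Fin d → Fin n
  x at i = finToFun {n} {d} x i

  _[_≔_] : V → Fin d → Fin n → V
  x [ c ≔ a ] = funToFin (updateAt (x at_) c (const a))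

  at-≔ : ∀ x c a → x [ c ≔ a ] at c ≡ a
  at-≔ x c a = trans (finToFun-funToFin (updateAt (x at_) c (const a)) c)
                     (updateAt-updates c (x at_))

  at-≔′ : ∀ x c a {i} → i ≢ c → x [ c ≔ a ] at i ≡ x at i
  at-≔′ x c a {i} i≢c = trans (finToFun-funToFin (updateAt (x at_) c (const a)) i)
                              (updateAt-minimal i c (x at_) i≢c)

  V-ext : ∀ {x y} → (∀ i → x at i ≡ y at i) → x ≡ y
  V-ext {x} {y} x≗y = trans (sym (funToFin-finToFin {d} {n} x))
                     (trans (funToFin-cong x≗y) (funToFin-finToFin {d} {n} y))

  agree⇒≡ : ∀ {x y c} → (∀ {i} → i ≢ c → x at i ≡ y at i) → x at c ≡ y at c → x ≡ y
  agree⇒≡ {x} {y} {c} off on = V-ext λ i → case i ≟ c of λ where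
    (yes refl) → on
    (no i≢c)   → off i≢c

  ≔-restore : ∀ {x z c a} → x [ c ≔ a ] ≡ z → z [ c ≔ x at c ] ≡ x
  ≔-restore {x} {c = c} {a} refl = agree⇒≡
    (λ i≢c → trans (at-≔′ (x [ c ≔ a ]) c (x at c) i≢c) (at-≔′ x c a i≢c))
    (at-≔ (x [ c ≔ a ]) c (x at c))

  -- If `x [ c ≔ a ] ≡ z`, then `a` is `z at c` and `x` is `z` with coordinate `c` changed, so at
  -- most `n` pairs `(x , a)` lead to `z`.
  ∑-lines : ∀ c (f : V → ℕ) →
            ∑[ x < n ^ d ] ∑[ a < n ] f (x [ c ≔ a ]) ≤ n * sum f
  ∑-lines c = ∑-fibres (λ x a → x [ c ≔ a ]) λ z → begin
    ∑[ x < N ] ∑[ a < n ] ind (x [ c ≔ a ] ≟ z)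
      ≤⟨ (∑-mono {N} λ x → ∑-mono {n} λ a → restores z x a) ⟩
    ∑[ x < N ] ∑[ a < n ] (ind (z at c ≟ a) * preimages z x)
      ≡⟨ (sum-cong-≗ {N} λ x → ∑-ind (z at c) (const (preimages z x))) ⟩
    ∑[ x < N ] ∑[ b < n ] ind (z [ c ≔ b ] ≟ x)
      ≡⟨ (∑-comm {N} {n} λ x b → ind (z [ c ≔ b ] ≟ x)) ⟩
    ∑[ b < n ] ∑[ x < N ] ind (z [ c ≔ b ] ≟ x)
      ≡⟨ (sum-cong-≗ {n} λ b → ∑-ind₁ (z [ c ≔ b ])) ⟩
    ∑[ b < n ] 1
      ≡⟨ trans (∑-const n 1) (*-identityʳ n) ⟩
    n ∎
    where
    open ≤-Reasoning
    N = n ^ d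
    preimages : V → V → ℕ
    preimages z x = ∑[ b < n ] ind (z [ c ≔ b ] ≟ x)
    restores : ∀ z x a → ind (x [ c ≔ a ] ≟ z) ≤ ind (z at c ≟ a) * preimages z x
    restores z x a with x [ c ≔ a ] ≟ z
    ... | no _ = z≤n
    ... | yes eq = *-mono-≤
      (≤-reflexive (sym (ind-yes (z at c ≟ a) (trans (cong (_at c) (sym eq)) (at-≔ x c a)))))
      (≤-trans (≤-reflexive (sym (ind-yes (z [ c ≔ x at c ] ≟ x) (≔-restore eq))))
               (term≤∑ (λ b → ind (z [ c ≔ b ] ≟ x)) (x at c)))

  -- The point `x` serves to name a line of direction `c`, its coordinate `c` being overwritten in
  -- every use; this spares a choice of representatives for the lines.
  ∑ₚ : (V → Fin d → Fin n → Fin n → ℕ) → ℕ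
  ∑ₚ F = ∑[ x < n ^ d ] ∑[ c < d ] ∑[ a < n ] ∑[ b < n ] F x c a b

  ∑ₚ-mono : ∀ {F G} → (∀ x c a b → F x c a b ≤ G x c a b) → ∑ₚ F ≤ ∑ₚ G
  ∑ₚ-mono F≤G = ∑-mono λ x → ∑-mono λ c → ∑-mono λ a → ∑-mono λ b → F≤G x c a b

  ∑ₚ-+ : ∀ F G → ∑ₚ (λ x c a b → F x c a b + G x c a b) ≡ ∑ₚ F + ∑ₚ G
  ∑ₚ-+ F G = trans
    (sum-cong-≗ {n ^ d} λ x → trans
      (sum-cong-≗ {d} λ c → trans
        (sum-cong-≗ {n} λ a → ∑-distrib-+ (F x c a) (G x c a))
        (∑-distrib-+ {n} _ _))
      (∑-distrib-+ {d} _ _))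
    (∑-distrib-+ {n ^ d} _ _)

  ∑ₚ-* : ∀ m F → m * ∑ₚ F ≡ ∑ₚ (λ x c a b → m * F x c a b)
  ∑ₚ-* m F = trans (*-distribˡ-sum {n ^ d} m _)
    (sum-cong-≗ {n ^ d} λ x → trans (*-distribˡ-sum {d} m _)
      (sum-cong-≗ {d} λ c → trans (*-distribˡ-sum {n} m _)
        (sum-cong-≗ {n} λ a → *-distribˡ-sum {n} m _)))

  ∑ₚ-comm : ∀ {m} (F : Fin m → V → Fin d → Fin n → Fin n → ℕ) →
            ∑[ i < m ] ∑ₚ (F i) ≡ ∑ₚ (λ x c a b → ∑[ i < m ] F i x c a b)
  ∑ₚ-comm {m} F = trans (∑-comm {m} {n ^ d} _)
    (sum-cong-≗ {n ^ d} λ x → trans (∑-comm {m} {d} _)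
      (sum-cong-≗ {d} λ c → trans (∑-comm {m} {n} _)
        (sum-cong-≗ {n} λ a → ∑-comm {m} {n} _)))

  ∑ₚ-search : ∀ F {B} → n ^ d * (d * (n * (n * B))) < ∑ₚ F →
              ∃[ x ] ∃[ c ] ∃[ a ] ∃[ b ] B < F x c a b
  ∑ₚ-search F lt =
    let x , ltₓ = ∑-search {n ^ d} _ lt
        c , lt꜀ = ∑-search {d} _ ltₓ
        a , ltₐ = ∑-search {n} _ lt꜀
        b , ltᵇ = ∑-search {n} _ ltₐ
    in x , c , a , b , ltᵇ

-- The greedy construction: parameters and matchings.

module Greedy (d k g m : ℕ) .{{_ : NonZero d}} .{{_ : NonZero k}} (1+m≡2k : suc m ≡ 2 * k) where

  -- `D` counts the sequences of `g` moves, each resting or following one of `d` colours. In `n`,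
  -- the factor `4 * D` makes pairs joined by short walks rare, and the factor `k` lets
  -- `monochromatic-pairs` apply to each line.
  D n N K : ℕ
  D = suc d ^ g
  n = k * (4 * D)
  N = n ^ d
  K = k ^ N

  open Hamming n d public

  colouring : Fin K → V → Fin k
  colouring = finToFun {k} {N}

  Collinear : Fin d → V → V → Set
  Collinear c u v = ∀ {i} → i ≢ c → u at i ≡ v at i

  collinear : ∀ x c a b → Collinear c (x [ c ≔ a ]) (x [ c ≔ b ])
  collinear x c a b i≢c = trans (at-≔′ x c a i≢c) (sym (at-≔′ x c b i≢c))

  -- The edges of colour c are the pairs {u , mate c u} with mate c u ≢ u.
  record Matchings : Set where
    field
      mate       : Fin d → V → V
      involutive : ∀ c u → mate c (mate c u) ≡ u
      along      : ∀ c u → Collinear c (mate c u) u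

    E : Rel V 0ℓ
    E u v = ∃[ c ] (mate c u ≡ v × u ≢ v)

    E-sym : Symmetric E
    E-sym {u} (c , refl , u≢v) = c , involutive c u , u≢v ∘ sym

    matched : Fin d → V → ℕ
    matched c u = ind (¬? (mate c u ≟ u))

    -- Counts the sequences of `r` moves from `u` to `v`, a move being to rest or to apply one
    -- `mate c`. Rests pad shorter walks; at an unmatched vertex `mate c` is a further rest.
    walks : ℕ → V → V → ℕ
    walks zero    u v = ind (u ≟ v)
    walks (suc r) u v = walks r u v + ∑[ c < d ] walks r (mate c u) v

    -- There are `suc d ^ r` sequences of moves from `u`, and each ends in at most one of the points
    -- `x [ c ≔ b ]`.
    walks-line : ∀ r u x c → ∑[ b < n ] walks r u (x [ c ≔ b ]) ≤ suc d ^ r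
    walks-line zero u x c = ≤-trans
      (∑-mono {n} λ b → ind-mono (u ≟ x [ c ≔ b ]) (u at c ≟ b)
                                 λ u≡ → trans (cong (_at c) u≡) (at-≔ x c b))
      (≤-reflexive (∑-ind₁ {n} (u at c)))
    walks-line (suc r) u x c = begin
      ∑[ b < n ] (walks r u (x [ c ≔ b ]) + ∑[ e < d ] walks r (mate e u) (x [ c ≔ b ]))
        ≡⟨ ∑-distrib-+ {n} _ _ ⟩
      ∑[ b < n ] walks r u (x [ c ≔ b ]) + ∑[ b < n ] ∑[ e < d ] walks r (mate e u) (x [ c ≔ b ])
        ≡⟨ cong (∑[ b < n ] walks r u (x [ c ≔ b ]) +_)
                (∑-comm {n} {d} λ b e → walks r (mate e u) (x [ c ≔ b ])) ⟩
      ∑[ b < n ] walks r u (x [ c ≔ b ]) + ∑[ e < d ] ∑[ b < n ] walks r (mate e u) (x [ c ≔ b ])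
        ≤⟨ +-mono-≤ (walks-line r u x c) (∑-upper {d} λ e → walks-line r (mate e u) x c) ⟩
      suc d ^ r + d * suc d ^ r ∎
      where open ≤-Reasoning

    walks-path : ∀ {u v l r} → Path E u v l → l ≤ r → 0 < walks r u v
    walks-path {u} {r = zero}  nil _ = ≤-reflexive (sym (ind-yes (u ≟ u) refl))
    walks-path {u} {r = suc r} nil _ = ≤-trans (walks-path {r = r} nil z≤n) (m≤m+n _ _)
    walks-path {u} {v} {r = suc r} (cons (c , refl , _) p) (s≤s l≤r) = ≤-trans
      (≤-trans (walks-path p l≤r) (term≤∑ (λ e → walks r (mate e u) v) c)) (m≤n+m _ _)

    -- As rests are counted, the last condition also forces `u ≢ v`.
    Free : V → V → Fin d → Set
    Free u v c = mate c u ≡ u × mate c v ≡ v × walks g u v ≡ 0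

    free? : ∀ u v c → Dec (Free u v c)
    free? u v c = mate c u ≟ u ×-dec mate c v ≟ v ×-dec walks g u v ℕ.≟ 0

    -- A union bound over the three ways of being blocked; `y` will be the indicator of a
    -- monochromatic pair.
    free-or-blocked : ∀ u v c {y} → y ≤ 1 →
      y ≤ ind (free? u v c) * y + (matched c u + matched c v + walks g u v)
    free-or-blocked u v c {y} y≤1 with mate c u ≟ u | mate c v ≟ v | walks g u v
    ... | no _  | _     | _     = ≤-trans y≤1 (s≤s z≤n)
    ... | yes _ | no _  | _     = ≤-trans y≤1 (s≤s z≤n)
    ... | yes _ | yes _ | zero  = ≤-trans (≤-reflexive (sym (*-identityˡ y))) (m≤m+n _ _)
    ... | yes _ | yes _ | suc _ = ≤-trans y≤1 (s≤s z≤n)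

  open Matchings

  -- Adding one edge to the matchings.

  module AddEdge (M : Matchings) (c₀ : Fin d) (s t : V) (s≢t : s ≢ t)
                 (s-free : mate M c₀ s ≡ s) (t-free : mate M c₀ t ≡ t)
                 (st : Collinear c₀ s t) where

    newMate : Fin d → V → V
    newMate c u with c ≟ c₀ | u ≟ s | u ≟ t
    ... | yes _ | yes _ | _     = t
    ... | yes _ | no _  | yes _ = s
    ... | yes _ | no _  | no _  = mate M c u
    ... | no _  | _     | _     = mate M c u

    data View (c : Fin d) (u : V) : V → Set where
      kept    : View c u (mate M c u)
      forward : c ≡ c₀ → u ≡ s → View c u t
      back    : c ≡ c₀ → u ≡ t → View c u s

    view : ∀ c u → View c u (newMate c u)
    view c u with c ≟ c₀ | u ≟ s | u ≟ t
    ... | yes c≡ | yes u≡ | _      = forward c≡ u≡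
    ... | yes c≡ | no _   | yes u≡ = back c≡ u≡
    ... | yes _  | no _   | no _   = kept
    ... | no _   | _      | _      = kept

    newMate-s : newMate c₀ s ≡ t
    newMate-s with c₀ ≟ c₀ | s ≟ s
    ... | yes _ | yes _ = refl
    ... | no ≢  | _     = contradiction refl ≢
    ... | yes _ | no ≢  = contradiction refl ≢

    newMate-t : newMate c₀ t ≡ s
    newMate-t with c₀ ≟ c₀ | t ≟ s | t ≟ t
    ... | yes _ | no _   | yes _ = refl
    ... | yes _ | yes t≡ | _     = contradiction (sym t≡) s≢t
    ... | yes _ | no _   | no ≢  = contradiction refl ≢
    ... | no ≢  | _      | _     = contradiction refl ≢

    -- The ends of the new edge were unmatched in colour `c₀`, so no old edge is overwritten.
    newMate-kept : ∀ c u → mate M c u ≢ u → newMate c u ≡ mate M c u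
    newMate-kept c u moved with newMate c u | view c u
    ... | _ | kept              = refl
    ... | _ | forward refl refl = contradiction s-free moved
    ... | _ | back    refl refl = contradiction t-free moved

    newMate-involutive : ∀ c u → newMate c (newMate c u) ≡ u
    newMate-involutive c u with newMate c u in eq | view c u
    ... | _ | forward refl refl = newMate-t
    ... | _ | back    refl refl = newMate-s
    ... | _ | kept with mate M c u ≟ u
    -- Here `eq` shows that `newMate c` fixes `u` as well.
    ...   | yes fixed = trans (cong (newMate c) fixed) (trans eq fixed)
    ...   | no moved = trans (newMate-kept c (mate M c u) moved′) (involutive M c u)
      where
      moved′ : mate M c (mate M c u) ≢ mate M c u
      moved′ ≡ = moved (trans (sym ≡) (involutive M c u))

    newMate-along : ∀ c u → Collinear c (newMate c u) u
    newMate-along c u i≢c with newMate c u | view c u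
    ... | _ | kept              = along M c u i≢c
    ... | _ | forward refl refl = sym (st i≢c)
    ... | _ | back    refl refl = st i≢c

    new : Matchings
    new = record { mate = newMate ; involutive = newMate-involutive ; along = newMate-along }

    E-extends : ∀ {u v} → E new u v → Extends (E M) s t u v
    E-extends {u} (c , refl , u≢v) with newMate c u | view c u
    ... | _ | kept         = old (c , refl , u≢v)
    ... | _ | forward _ u≡ = forward u≡ refl
    ... | _ | back _ u≡    = back u≡ refl

    matched-new : ∑[ c < d ] sum (matched new c) ≤ ∑[ c < d ] sum (matched M c) + 2
    matched-new = begin
      ∑[ c < d ] ∑[ u < N ] matched new c u
        ≤⟨ (∑-mono {d} λ c → ∑-mono {N} λ u → pointwise c u) ⟩
      ∑[ c < d ] ∑[ u < N ] (matched M c u + ind (c₀ ≟ c) * (ind (s ≟ u) + ind (t ≟ u)))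
        ≡⟨ (sum-cong-≗ {d} λ c → trans (∑-distrib-+ {N} (matched M c) _) (cong (sum (matched M c) +_) (ends c))) ⟩
      ∑[ c < d ] (sum (matched M c) + ind (c₀ ≟ c) * 2)
        ≡⟨ ∑-distrib-+ {d} (λ c → sum (matched M c)) (λ c → ind (c₀ ≟ c) * 2) ⟩
      ∑[ c < d ] sum (matched M c) + ∑[ c < d ] (ind (c₀ ≟ c) * 2)
        ≡⟨ cong (∑[ c < d ] sum (matched M c) +_) (∑-ind c₀ (const 2)) ⟩
      ∑[ c < d ] sum (matched M c) + 2 ∎
      where
      open ≤-Reasoning
      ends : ∀ c → ∑[ u < N ] (ind (c₀ ≟ c) * (ind (s ≟ u) + ind (t ≟ u))) ≡ ind (c₀ ≟ c) * 2
      ends c = trans (sym (*-distribˡ-sum {N} (ind (c₀ ≟ c)) _))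
        (cong (ind (c₀ ≟ c) *_) (trans (∑-distrib-+ {N} (λ u → ind (s ≟ u)) (λ u → ind (t ≟ u)))
                                       (cong₂ _+_ (∑-ind₁ {N} s) (∑-ind₁ {N} t))))
      pointwise : ∀ c u → matched new c u ≤
                          matched M c u + ind (c₀ ≟ c) * (ind (s ≟ u) + ind (t ≟ u))
      pointwise c u with newMate c u | view c u
      ... | _ | kept = m≤m+n _ _
      ... | _ | forward refl refl = ≤-trans (ind≤1 (¬? (t ≟ s))) (≤-trans hit (m≤n+m _ _))
        where
        hit : 1 ≤ ind (c ≟ c) * (ind (s ≟ s) + ind (t ≟ s))
        hit rewrite ind-yes (c ≟ c) refl | ind-yes (s ≟ s) refl = s≤s z≤n
      ... | _ | back refl refl = ≤-trans (ind≤1 (¬? (s ≟ t))) (≤-trans hit (m≤n+m _ _))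
        where
        hit : 1 ≤ ind (c ≟ c) * (ind (s ≟ t) + ind (t ≟ t))
        hit rewrite ind-yes (c ≟ c) refl | ind-yes (t ≟ t) refl =
          ≤-trans (m≤n+m 1 (ind (s ≟ t))) (m≤m+n _ 0)

  -- The greedy invariant and the counting of pairs.

  Monochromatic : Matchings → Fin K → Set
  Monochromatic M f = ∃₂ λ c u → mate M c u ≢ u × colouring f u ≡ colouring f (mate M c u)

  -- Only k-colourings of positive weight can still be proper.
  record Stage (j : ℕ) : Set where
    field
      M       : Matchings
      acyclic : NoShortCycle (E M) g
      edges   : ∑[ c < d ] sum (matched M c) ≤ 2 * j
      weight  : Fin K → ℕ
      dead    : ∀ f → weight f ≡ 0 → Monochromatic M f
      decay   : suc m ^ j * sum weight ≤ m ^ j * K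

  open Stage

  -- The number of (x , c , a , b); the pair {x [ c ≔ a ] , x [ c ≔ b ]} is
  -- counted once for each of the n points x on its line and each order.
  pairs : ℕ
  pairs = N * (d * (n * n))

  mono : Fin K → V → Fin d → Fin n → Fin n → ℕ
  mono f x c a b = ind (colouring f (x [ c ≔ a ]) ≟ colouring f (x [ c ≔ b ]))

  mono-lower : ∀ f → pairs ≤ k * ∑ₚ (mono f)
  mono-lower f = begin
    N * (d * (n * n))
      ≤⟨ (∑-lower {N} λ x → ∑-lower {d} λ c →
            monochromatic-pairs k (4 * D) (λ a → colouring f (x [ c ≔ a ]))) ⟩
    ∑[ x < N ] ∑[ c < d ] (k * (∑[ a < n ] ∑[ b < n ] mono f x c a b))
      ≡⟨ trans (*-distribˡ-sum {N} k _) (sum-cong-≗ {N} λ x → *-distribˡ-sum {d} k _) ⟨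
    k * ∑ₚ (mono f) ∎
    where open ≤-Reasoning

  -- One factor `n` comes from the idle index `a`, the other from `∑-lines`.
  ∑ₚ-second : (h : Fin d → V → ℕ) →
              ∑ₚ (λ x c a b → h c (x [ c ≔ b ])) ≤ n * (n * (∑[ c < d ] sum (h c)))
  ∑ₚ-second h = begin
    ∑[ x < N ] ∑[ c < d ] ∑[ a < n ] ∑[ b < n ] h c (x [ c ≔ b ])
      ≡⟨ (sum-cong-≗ {N} λ x → sum-cong-≗ {d} λ c → ∑-const n _) ⟩
    ∑[ x < N ] ∑[ c < d ] (n * (∑[ b < n ] h c (x [ c ≔ b ])))
      ≡⟨ trans (*-distribˡ-sum {N} n _) (sum-cong-≗ {N} λ x → *-distribˡ-sum {d} n _) ⟨
    n * (∑[ x < N ] ∑[ c < d ] ∑[ b < n ] h c (x [ c ≔ b ]))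
      ≡⟨ cong (n *_) (∑-comm {N} {d} _) ⟩
    n * (∑[ c < d ] ∑[ x < N ] ∑[ b < n ] h c (x [ c ≔ b ]))
      ≤⟨ *-monoʳ-≤ n (∑-mono {d} λ c → ∑-lines c (h c)) ⟩
    n * (∑[ c < d ] (n * sum (h c)))
      ≡⟨ cong (n *_) (*-distribˡ-sum {d} n _) ⟨
    n * (n * (∑[ c < d ] sum (h c))) ∎
    where open ≤-Reasoning

  ∑ₚ-first : (h : Fin d → V → ℕ) →
             ∑ₚ (λ x c a b → h c (x [ c ≔ a ])) ≤ n * (n * (∑[ c < d ] sum (h c)))
  ∑ₚ-first h = ≤-trans
    (≤-reflexive (sum-cong-≗ {N} λ x → sum-cong-≗ {d} λ c → ∑-comm {n} {n} λ a b → h c (x [ c ≔ a ])))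
    (∑ₚ-second h)

  -- One greedy step.

  module Step {j : ℕ} (small : 16 * k * j ≤ N * d) (S : Stage j) where

    free : V → Fin d → Fin n → Fin n → ℕ
    free x c a b = ind (free? (M S) (x [ c ≔ a ]) (x [ c ≔ b ]) c)

    blocked : V → Fin d → Fin n → Fin n → ℕ
    blocked x c a b = matched (M S) c (x [ c ≔ a ]) + matched (M S) c (x [ c ≔ b ])
                    + walks (M S) g (x [ c ≔ a ]) (x [ c ≔ b ])

    blocked-upper : ∑ₚ blocked ≤ n * (n * (2 * j)) + n * (n * (2 * j)) + N * (d * (n * D))
    blocked-upper = begin
      ∑ₚ blocked
        ≡⟨ trans (∑ₚ-+ _ _) (cong (_+ ∑ₚ (λ x c a b → walks (M S) g (x [ c ≔ a ]) (x [ c ≔ b ]))) (∑ₚ-+ _ _)) ⟩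
      ∑ₚ (λ x c a b → matched (M S) c (x [ c ≔ a ])) + ∑ₚ (λ x c a b → matched (M S) c (x [ c ≔ b ]))
        + ∑ₚ (λ x c a b → walks (M S) g (x [ c ≔ a ]) (x [ c ≔ b ]))
        ≤⟨ +-mono-≤ (+-mono-≤ (≤-trans (∑ₚ-first (matched (M S))) few)
                              (≤-trans (∑ₚ-second (matched (M S))) few))
                    (∑-upper {N} λ x → ∑-upper {d} λ c → ∑-upper {n} λ a → walks-line (M S) g (x [ c ≔ a ]) x c) ⟩
      n * (n * (2 * j)) + n * (n * (2 * j)) + N * (d * (n * D)) ∎
      where
      open ≤-Reasoning
      few : n * (n * (∑[ c < d ] sum (matched (M S) c))) ≤ n * (n * (2 * j))
      few = *-monoʳ-≤ n (*-monoʳ-≤ n (edges S))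

    -- Each kind of blocking gets half of the budget: matched ends by `small`, short walks because
    -- `n` is `k * (4 * D)`.
    blocked-few : 2 * k * ∑ₚ blocked ≤ pairs
    blocked-few = *-cancelˡ-≤ 2 (begin
      2 * (2 * k * ∑ₚ blocked)
        ≤⟨ *-monoʳ-≤ 2 (*-monoʳ-≤ (2 * k) blocked-upper) ⟩
      2 * (2 * k * (n * (n * (2 * j)) + n * (n * (2 * j)) + N * (d * (n * D))))
        ≡⟨ identity₁ k n j N d D ⟩
      n * (n * (16 * k * j)) + N * (d * (n * (k * (4 * D))))
        ≤⟨ +-monoˡ-≤ _ (*-monoʳ-≤ n (*-monoʳ-≤ n small)) ⟩
      n * (n * (N * d)) + N * (d * (n * n))
        ≡⟨ identity₂ n N d ⟩
      2 * pairs ∎)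
      where
      open ≤-Reasoning
      identity₁ : ∀ k n j N d D →
        2 * (2 * k * (n * (n * (2 * j)) + n * (n * (2 * j)) + N * (d * (n * D)))) ≡
        n * (n * (16 * k * j)) + N * (d * (n * (k * (4 * D))))
      identity₁ = solve-∀
      identity₂ : ∀ n N d → n * (n * (N * d)) + N * (d * (n * n)) ≡ 2 * (N * (d * (n * n)))
      identity₂ = solve-∀

    free-mono : Fin K → V → Fin d → Fin n → Fin n → ℕ
    free-mono f x c a b = free x c a b * mono f x c a b

    -- A share of at least `1/k` is monochromatic and at most `1/2k` is blocked. Adding `pairs` to
    -- both sides avoids subtraction.
    free-mono-lower : ∀ f → pairs ≤ 2 * k * ∑ₚ (free-mono f)
    free-mono-lower f = +-cancelʳ-≤ pairs _ _ (begin
      pairs + pairs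
        ≤⟨ +-mono-≤ (mono-lower f) (mono-lower f) ⟩
      k * ∑ₚ (mono f) + k * ∑ₚ (mono f)
        ≡⟨ identity k (∑ₚ (mono f)) ⟩
      2 * k * ∑ₚ (mono f)
        ≤⟨ *-monoʳ-≤ (2 * k) (∑ₚ-mono λ x c a b →
             free-or-blocked (M S) (x [ c ≔ a ]) (x [ c ≔ b ]) c
               (ind≤1 (colouring f (x [ c ≔ a ]) ≟ colouring f (x [ c ≔ b ])))) ⟩
      2 * k * ∑ₚ (λ x c a b → free-mono f x c a b + blocked x c a b)
        ≡⟨ trans (cong (2 * k *_) (∑ₚ-+ _ _)) (*-distribˡ-+ (2 * k) (∑ₚ (free-mono f)) (∑ₚ blocked)) ⟩
      2 * k * ∑ₚ (free-mono f) + 2 * k * ∑ₚ blocked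
        ≤⟨ +-monoʳ-≤ _ blocked-few ⟩
      2 * k * ∑ₚ (free-mono f) + pairs ∎)
      where
      open ≤-Reasoning
      identity : ∀ k x → k * x + k * x ≡ 2 * k * x
      identity = solve-∀

    -- The factor `2 * k` makes the average gain at least the total weight.
    gain : V → Fin d → Fin n → Fin n → ℕ
    gain x c a b = ∑[ f < K ] (weight S f * (2 * k * free-mono f x c a b))

    gain-lower : sum (weight S) * pairs ≤ ∑ₚ gain
    gain-lower = begin
      sum (weight S) * pairs
        ≡⟨ *-distribʳ-sum {K} pairs (weight S) ⟩
      ∑[ f < K ] (weight S f * pairs)
        ≤⟨ (∑-mono {K} λ f → *-monoʳ-≤ (weight S f) (free-mono-lower f)) ⟩
      ∑[ f < K ] (weight S f * (2 * k * ∑ₚ (free-mono f)))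
        ≡⟨ (sum-cong-≗ {K} λ f → trans (cong (weight S f *_) (∑ₚ-* (2 * k) (free-mono f)))
                                       (∑ₚ-* (weight S f) _)) ⟩
      ∑[ f < K ] ∑ₚ (λ x c a b → weight S f * (2 * k * free-mono f x c a b))
        ≡⟨ ∑ₚ-comm {K} _ ⟩
      ∑ₚ gain ∎
      where open ≤-Reasoning

    -- Writing the total as `suc s` turns "at least the total weight" into the strict bound of
    -- `∑ₚ-search`; strictness rests on `pairs` being positive.
    best : ∀ {s} → sum (weight S) ≡ suc s → ∃[ x ] ∃[ c ] ∃[ a ] ∃[ b ] s < gain x c a b
    best {s} total = ∑ₚ-search gain (begin-strict
      N * (d * (n * (n * s)))  ≡⟨ identity N d n s ⟩
      s * pairs                <⟨ *-monoˡ-< pairs (n<1+n s) ⟩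
      suc s * pairs            ≡⟨ cong (_* pairs) total ⟨
      sum (weight S) * pairs   ≤⟨ gain-lower ⟩
      ∑ₚ gain                  ∎)
      where
      open ≤-Reasoning
      identity : ∀ N d n s → N * (d * (n * (n * s))) ≡ s * (N * (d * (n * n)))
      identity = solve-∀
      instance
        nonZeroD : NonZero D
        nonZeroD = m^n≢0 (suc d) g
        nonZeroN : NonZero n
        nonZeroN = m*n≢0 k (4 * D) {{it}} {{m*n≢0 4 D}}
        nonZeroPairs : NonZero pairs
        nonZeroPairs = m*n≢0 N (d * (n * n)) {{m^n≢0 n d}} {{m*n≢0 d (n * n) {{it}} {{m*n≢0 n n}}}}

    -- A pair that is not free gains nothing, so a positive gain already selects a free pair.
    gain-free : ∀ {s} x c a b → s < gain x c a b → Free (M S) (x [ c ≔ a ]) (x [ c ≔ b ]) c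
    gain-free x c a b large = case free? (M S) (x [ c ≔ a ]) (x [ c ≔ b ]) c of λ where
        (yes p) → p
        (no ¬p) → contradiction large (≤⇒≯ (≤-trans (≤-reflexive (gain≡0 ¬p)) z≤n))
      where
      zero-product : ∀ w l {i} y → i ≡ 0 → w * (l * (i * y)) ≡ 0
      zero-product w l y refl = trans (cong (w *_) (*-zeroʳ l)) (*-zeroʳ w)
      gain≡0 : ¬ Free (M S) (x [ c ≔ a ]) (x [ c ≔ b ]) c → gain x c a b ≡ 0
      gain≡0 ¬p = trans
        (sum-cong-≗ {K} λ f → zero-product (weight S f) (2 * k) (mono f x c a b)
                                (ind-no (free? (M S) (x [ c ≔ a ]) (x [ c ≔ b ]) c) ¬p))
        (trans (∑-const K 0) (*-zeroʳ K))

    module Chosen {s} (total : sum (weight S) ≡ suc s) (x : V) (c : Fin d) (a b : Fin n)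
                  (large : s < gain x c a b) where

      u v : V
      u = x [ c ≔ a ]
      v = x [ c ≔ b ]

      kill : Fin K → ℕ
      kill f = mono f x c a b

      uv-free : Free (M S) u v c
      uv-free = gain-free x c a b large

      far : NoPath (E (M S)) g u v
      far l≤g p = <⇒≢ (walks-path (M S) p l≤g) (sym (proj₂ (proj₂ uv-free)))

      u≢v : u ≢ v
      u≢v u≡v = far z≤n (subst (λ w → Path (E (M S)) u w 0) u≡v nil)

      open AddEdge (M S) c u v u≢v (proj₁ uv-free) (proj₁ (proj₂ uv-free)) (collinear x c a b)

      weight′ : Fin K → ℕ
      weight′ f = weight S f * ind (¬? (colouring f u ≟ colouring f v))

      killed : ℕ
      killed = ∑[ f < K ] (weight S f * kill f)

      weight-split : sum weight′ + killed ≡ sum (weight S)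
      weight-split = trans (sym (∑-distrib-+ {K} weight′ _)) (sum-cong-≗ {K} λ f → split f)
        where
        split : ∀ f → weight′ f + weight S f * kill f ≡ weight S f
        split f with colouring f u ≟ colouring f v
        ... | yes _ = cong₂ _+_ (*-zeroʳ (weight S f)) (*-identityʳ (weight S f))
        ... | no _  = trans (cong₂ _+_ (*-identityʳ (weight S f)) (*-zeroʳ (weight S f))) (+-identityʳ _)

      killed-lower : sum (weight S) ≤ suc m * killed
      killed-lower = begin
        sum (weight S)                               ≡⟨ total ⟩
        suc s                                        ≤⟨ large ⟩
        gain x c a b                                 ≤⟨ (∑-mono {K} λ f → bound f) ⟩
        ∑[ f < K ] (2 * k * (weight S f * kill f))   ≡⟨ *-distribˡ-sum {K} (2 * k) _ ⟨
        2 * k * killed                               ≡⟨ cong (_* killed) 1+m≡2k ⟨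
        suc m * killed                               ∎
        where
        open ≤-Reasoning
        identity : ∀ w k y → w * (2 * k * y) ≡ 2 * k * (w * y)
        identity = solve-∀
        bound : ∀ f → weight S f * (2 * k * free-mono f x c a b) ≤ 2 * k * (weight S f * kill f)
        bound f = ≤-trans
          (*-monoʳ-≤ (weight S f) (*-monoʳ-≤ (2 * k)
            (≤-trans (*-monoˡ-≤ (kill f) (ind≤1 (free? (M S) u v c))) (≤-reflexive (*-identityˡ (kill f))))))
          (≤-reflexive (identity (weight S f) k (kill f)))

      -- At least `1/(m+1)`, that is `1/2k`, of the weight is killed, so at most `m/(m+1)` is left.
      weight′-upper : suc m * sum weight′ ≤ m * sum (weight S)
      weight′-upper = +-cancelʳ-≤ (sum (weight S)) _ _ (begin
        suc m * sum weight′ + sum (weight S)    ≤⟨ +-monoʳ-≤ _ killed-lower ⟩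
        suc m * sum weight′ + suc m * killed    ≡⟨ *-distribˡ-+ (suc m) (sum weight′) killed ⟨
        suc m * (sum weight′ + killed)          ≡⟨ cong (suc m *_) weight-split ⟩
        suc m * sum (weight S)                  ≡⟨ +-comm (sum (weight S)) _ ⟩
        m * sum (weight S) + sum (weight S)     ∎)
        where open ≤-Reasoning

      decay′ : suc m ^ suc j * sum weight′ ≤ m ^ suc j * K
      decay′ = begin
        suc m * suc m ^ j * sum weight′     ≡⟨ swap (suc m) (suc m ^ j) (sum weight′) ⟩
        suc m ^ j * (suc m * sum weight′)   ≤⟨ *-monoʳ-≤ (suc m ^ j) weight′-upper ⟩
        suc m ^ j * (m * sum (weight S))    ≡⟨ swap′ (suc m ^ j) m (sum (weight S)) ⟩
        m * (suc m ^ j * sum (weight S))    ≤⟨ *-monoʳ-≤ m (decay S) ⟩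
        m * (m ^ j * K)                     ≡⟨ *-assoc m (m ^ j) K ⟨
        m * m ^ j * K                       ∎
        where
        open ≤-Reasoning
        swap : ∀ a b c → a * b * c ≡ b * (a * c)
        swap = solve-∀
        swap′ : ∀ a b c → a * (b * c) ≡ b * (a * c)
        swap′ = solve-∀

      -- Either the new edge itself is monochromatic, or the weight was already zero and the earlier
      -- monochromatic edge survives.
      dead′ : ∀ f → weight′ f ≡ 0 → Monochromatic new f
      dead′ f w≡0 with colouring f u ≟ colouring f v | w≡0
      ... | yes same | _ = c , u , (λ u≡ → u≢v (trans (sym u≡) newMate-s))
                             , trans same (cong (colouring f) (sym newMate-s))
      ... | no _ | w₀ with e , y , moved , same ← dead S f (trans (sym (*-identityʳ (weight S f))) w₀)
                      with kept≡ ← newMate-kept e y moved =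
        e , y , moved ∘ trans (sym kept≡) , trans same (cong (colouring f) (sym kept≡))

      next : Stage (suc j)
      next = record
        { M       = new
        ; acyclic = noShortCycle-extend (E (M S)) (E new) g (acyclic S) E-extends far
                      λ l≤g p → far l≤g (reverseₚ (E-sym (M S)) p)
        ; edges   = ≤-trans matched-new (≤-trans (+-monoˡ-≤ 2 (edges S)) (≤-reflexive (two-more j)))
        ; weight  = weight′
        ; dead    = dead′
        ; decay   = decay′
        }
        where
        two-more : ∀ j → 2 * j + 2 ≡ 2 * suc j
        two-more = solve-∀

  -- Running the greedy procedure.

  start : Stage 0
  start = record
    { M       = record { mate = λ _ u → u ; involutive = λ _ _ → refl ; along = λ _ _ _ → refl }
    ; acyclic = λ { _ (cons (_ , refl , u≢u) _ _) → u≢u refl }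
    ; edges   = ≤-reflexive (trans (sum-cong-≗ {d} λ c → sum-cong-≗ {N} λ u → unmoved u) zeros)
    ; weight  = const 1
    ; dead    = λ _ ()
    ; decay   = ≤-reflexive (cong (1 *_) (trans (∑-const K 1) (*-identityʳ K)))
    }
    where
    unmoved : ∀ (u : V) → ind (¬? (u ≟ u)) ≡ 0
    unmoved u with u ≟ u
    ... | yes _ = refl
    ... | no ≢  = contradiction refl ≢
    zeros : ∑[ c < d ] ∑[ u < N ] 0 ≡ 0
    zeros = trans (∑-const d _) (trans (cong (d *_) (trans (∑-const N 0) (*-zeroʳ N))) (*-zeroʳ d))

  Exhausted : Set
  Exhausted = ∃[ j ] Σ[ S ∈ Stage j ] sum (weight S) ≡ 0

  -- `best` asks for positive total weight; a total of zero ends the run early, with the goal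
  -- already reached.
  stage : ∀ j → 16 * k * j ≤ N * d → Exhausted ⊎ Stage j
  stage zero    _ = inj₂ start
  stage (suc j) small with stage j (≤-trans (*-monoʳ-≤ (16 * k) (n≤1+n j)) small)
  ... | inj₁ done = inj₁ done
  ... | inj₂ S with sum (weight S) in total
  ...   | zero  = inj₁ (j , S , total)
  ...   | suc s =
    let small′ = ≤-trans (*-monoʳ-≤ (16 * k) (n≤1+n j)) small
        x , c , a , b , large = Step.best small′ S total
    in inj₂ (Step.Chosen.next small′ S total x c a b large)

  -- After `T` steps the total weight is at most `(m/(m+1))^T * k^N ≤ k^N / 2^(kN) < 1`, hence zero.
  -- The hypothesis keeps blocked pairs rare throughout these steps.
  exhausted : 16 * k * (suc m * (k * N)) ≤ N * d → Exhausted
  exhausted small with stage (suc m * (k * N)) small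
  ... | inj₁ done = done
  ... | inj₂ S with sum (weight S) in total
  ...   | zero  = _ , S , total
  ...   | suc s = contradiction (begin-strict
    suc m ^ T                      ≤⟨ m≤m*n (suc m ^ T) (suc s) ⟩
    suc m ^ T * suc s              ≡⟨ cong (suc m ^ T *_) total ⟨
    suc m ^ T * sum (weight S)     ≤⟨ decay S ⟩
    m ^ T * K                      <⟨ *-monoʳ-< (m ^ T) K<2^kN ⟩
    m ^ T * 2 ^ (k * N)            ≤⟨ m^-decay m (k * N) ⟩
    suc m ^ T                      ∎) (<-irrefl refl)
    where
    open ≤-Reasoning
    T = suc m * (k * N)
    instance
      nonZeroM : NonZero m
      nonZeroM = >-nonZero (s≤s⁻¹ (≤-trans (*-monoʳ-≤ 2 (>-nonZero⁻¹ k)) (≤-reflexive (sym 1+m≡2k))))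
      nonZeroMT : NonZero (m ^ T)
      nonZeroMT = m^n≢0 m T
      nonZeroN : NonZero N
      nonZeroN = m^n≢0 n d {{m*n≢0 k (4 * D) {{it}} {{m*n≢0 4 D {{it}} {{m^n≢0 (suc d) g}}}}}}
    K<2^kN : K < 2 ^ (k * N)
    K<2^kN = <-≤-trans (^-monoˡ-< N (n<2^n k)) (≤-reflexive (^-*-assoc 2 k N))

  -- The resulting graph and its edge-colouring.

  module _ (done : Exhausted) where

    private
      S : Stage (proj₁ done)
      S = proj₁ (proj₂ done)

    graph : Graph
    graph = record
      { Vertex = V
      ; order  = N
      ; finite = ↔-id V
      ; Adj    = E (M S)
      ; adj?   = λ u v → any? λ c → mate (M S) c u ≟ v ×-dec ¬? (u ≟ v)
      ; irrefl = λ { refl (_ , _ , u≢u) → u≢u refl }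
      ; symm   = E-sym (M S)
      }

    -- `vertices` omits the final vertex `w`, which will be the base of the cycle, so its
    -- distinctness from the others is carried separately.
    toReduced : ∀ {p u w} (r : Walk graph u w) → All (p ≢_) (vertices r) → p ≢ w →
                All (w ≢_) (vertices r) → Unique (vertices r) → Reduced (E (M S)) p u w (size r)
    toReduced nil _ _ _ _ = nil
    toReduced (cons e nil) _ p≢w _ _ = cons e (p≢w ∘ sym) nil
    toReduced (cons e r@(cons _ _)) (_ ∷ p≢v ∷ _) p≢w (w≢u ∷ w≢) (u≢ ∷ uniq) =
      cons e (p≢v ∘ sym) (toReduced r u≢ (w≢u ∘ sym) w≢ uniq)

    girth : GirthAtLeast g graph
    girth _ (record { walk = nil ; long = () } , refl)
    girth _ (record { walk = cons _ nil ; long = s≤s () } , refl)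
    girth _ (record { walk = cons _ (cons _ nil) ; long = s≤s (s≤s ()) } , refl)
    girth _ (record { walk = cons e₀ (cons e₁ r@(cons _ _)) ; distinct = (x₀≢x₁ ∷ x₀≢) ∷ x₁≢ ∷ uniq } , refl) =
      ≮⇒≥ λ short → acyclic S (<⇒≤ short)
        -- The base itself acts as the vertex preceding the start.
        (cons e₀ (x₀≢x₁ ∘ sym) (cons e₁ (All.head x₀≢ ∘ sym) (toReduced r x₁≢ (x₀≢x₁ ∘ sym) x₀≢ uniq)))

    -- A colouring with fewer than `k` colours is also one of the `K` colourings. As the total
    -- weight is zero, so is its own, and `dead` yields a monochromatic edge.
    chromatic : ChromaticNumberAtLeast k graph
    chromatic l (f , proper) = ≮⇒≥ λ l<k →
      let φ = λ u → inject≤ (f u) (<⇒≤ l<k)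
          index = funToFin φ
          weightless = n≤0⇒n≡0 (≤-trans (term≤∑ (weight S) index) (≤-reflexive (proj₂ (proj₂ done))))
          c , u , moved , same = dead S index weightless
          same′ = trans (sym (finToFun-funToFin φ u)) (trans same (finToFun-funToFin φ (mate (M S) c u)))
      in proper (c , refl , moved ∘ sym) (inject≤-injective _ _ _ _ same′)

    edge-crosses : ∀ {u v} (e : E (M S) u v) → u at proj₁ e ≢ v at proj₁ e
    edge-crosses (c , refl , u≢v) same = u≢v (sym (agree⇒≡ (along (M S) c _) (sym same)))

    edge-keeps : ∀ {u v} (e : E (M S) u v) {i} → i ≢ proj₁ e → u at i ≡ v at i
    edge-keeps (c , refl , _) i≢c = sym (along (M S) c _ i≢c)

    edgeColouring : EdgeColouring graph
    edgeColouring = record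
      { Colour   = Fin d
      ; _≟_      = _≟_
      ; colour   = proj₁
      -- The colour is the only coordinate in which the ends differ, so the ends determine it.
      ; coherent = λ e e′ → case proj₁ e ≟ proj₁ e′ of λ where
          (yes same) → same
          (no ≢)     → contradiction (sym (edge-keeps e′ ≢)) (edge-crosses e)
      }

    proper : Proper edgeColouring
    proper (c , refl , _) (.c , refl , _) v≢w refl = v≢w refl

    walkOccurrences : ∀ {u v} → Fin d → Walk graph u v → ℕ
    walkOccurrences c r = length (filter (c ≟_) (colours edgeColouring r))

    colour-absent : ∀ c {u v} (r : Walk graph u v) → walkOccurrences c r ≡ 0 → u at c ≡ v at c
    colour-absent c nil _ = refl
    colour-absent c (cons e r) absent with c ≟ proj₁ e
    ... | no c≢ = trans (edge-keeps e c≢) (colour-absent c r absent)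

    -- The single edge of colour `c` changes coordinate `c`, and by `colour-absent` nothing after it
    -- changes it back.
    colour-once : ∀ c {u v} (r : Walk graph u v) → walkOccurrences c r ≡ 1 → u at c ≢ v at c
    colour-once c (cons e r) once same with c ≟ proj₁ e
    ... | yes refl = edge-crosses e (trans same (sym (colour-absent c r (suc-injective once))))
    ... | no c≢    = colour-once c r once (trans (sym (edge-keeps e c≢)) same)

    noColourOnce : NoColourExactlyOnce edgeColouring
    noColourOnce C c once = colour-once c (Cycle.walk C) once refl

theorem1p1 : (g k : ℕ) → 1 ≤ g → 1 ≤ k →
    Σ[ G ∈ Graph ]
    (GirthAtLeast g G
    × ChromaticNumberAtLeast k G
    × (Σ[ κ ∈ EdgeColouring G ] (Proper κ × NoColourExactlyOnce κ)))
theorem1p1 g k@(suc k-1) _ _ =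
  G.graph done , G.girth done , G.chromatic done , G.edgeColouring done , G.proper done , G.noColourOnce done
  where
  -- `exhausted` runs for up to `2 * k * (k * N)` steps and asks that `16 * k` times this be at most
  -- `N * d`, whence `d = 32k³`. The form given to `m = 2k - 1` makes `suc m` reduce to `2 * k`.
  module G = Greedy (32 * (k * (k * k))) k g (k-1 + suc (k-1 + 0)) refl
  identity : ∀ k N → 16 * k * (2 * k * (k * N)) ≡ N * (32 * (k * (k * k)))
  identity = solve-∀
  done : G.Exhausted
  done = G.exhausted (≤-reflexive (identity k G.N))
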